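{- Let $n$ be an integer with $n\ge 6$ and $n\equiv 2 \pmod 4$. Then there exists a $2$-subset-regular self-complementary $3$-hypergraph on $n$ vertices.
   Context: For a set $V$ and a positive integer $k$, write $V^{(k)}=\{e\subseteq V : |e|=k\}$. A $k$-hypergraph (short for $k$-uniform hypergraph) of order $n$ (on $n$ vertices) is an ordered pair $\Gamma=(V,E)$, where $V=V(\Gamma)$ is a set of size $n$ and $E=E(\Gamma)$ is a subset of $V^{(k)}$. The complement of a $k$-hypergraph $\Gamma$ is the $k$-hypergraph $\Gamma^C$ with $V(\Gamma^C)=V(\Gamma)$ and $E(\Gamma^C)=V(\Gamma)^{(k)}\setminus E(\Gamma)$. A $k$-hypergraph $\Gamma=(V,E)$ is self-complementary if it is isomorphic to $\Gamma^C$; equivalently, if there exists a permutation $\tau$ of $V$ such that for all $e\in V^{(k)}$ one has $e\in E$ if and only if $e^\tau\notin E$, where $e^\tau$ denotes the image of the set $e$ under $\tau$. A $k$-hypergraph $\Gamma$ is $t$-subset-regular if there exists an integer $\lambda$ such that each $t$-element subset of $V(\Gamma)$ is a subset of exactly $\lambda$ elements of $E(\Gamma)$. -}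

module Defs where

open import Data.Bool.Base using (true; false)
open import Data.Fin.Permutation using (Permutation; _⟨$⟩ˡ_)
open import Data.Fin.Subset using (Subset; inside; outside; _⊆_; ∣_∣)
open import Data.Fin.Subset.Properties using (_⊆?_)
open import Data.List.Base using (List; []; _∷_; _++_; map; filter; length)
open import Data.List.Membership.Propositional using (_∈_)
open import Data.List.Membership.Propositional.Properties
  using (∈-++⁺ˡ; ∈-++⁺ʳ; ∈-map⁺; ∈-map⁻)
open import Data.List.Relation.Unary.Any using (here)
open import Data.List.Relation.Unary.All using ([])
open import Data.List.Relation.Unary.AllPairs using ([]; _∷_)
open import Data.List.Relation.Unary.Unique.Propositional using (Unique)
open import Data.List.Relation.Unary.Unique.Propositional.Properties
  using (++⁺; map⁺)
open import Data.Nat.Base using (ℕ; zero; suc)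
open import Data.Nat.Properties using (_≟_)
open import Data.Product.Base using (∃-syntax; _×_; _,_; proj₁)
open import Data.Vec.Base using ([]; _∷_; lookup; tabulate)
open import Data.Vec.Properties using (∷-injectiveʳ)
open import Function.Bundles using (_⇔_)
open import Level using (0ℓ)
open import Relation.Binary.PropositionalEquality using (_≡_; refl)
open import Relation.Nullary.Decidable using (_×-dec_; ¬?)
open import Relation.Nullary.Negation using (¬_)
open import Relation.Unary using (Pred; Decidable)

-- The vertex set is Fin n.  A set of edges is a decidable predicate, so that
-- classical complementation and counting make sense.
record Hypergraph (k n : ℕ) : Set₁ where
  field
    Edge    : Pred (Subset n) 0ℓ
    edge?   : Decidable Edge
    uniform : ∀ {e} → Edge e → ∣ e ∣ ≡ k

open Hypergraph public

complement : ∀ {k n} → Hypergraph k n → Hypergraph k n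
complement {k} Γ = record
  { Edge    = λ e → ∣ e ∣ ≡ k × ¬ Edge Γ e
  ; edge?   = λ e → (∣ e ∣ ≟ k) ×-dec ¬? (edge? Γ e)
  ; uniform = proj₁
  }

-- A point y lies in the image of e exactly when π⁻¹ y lies in e.
image : ∀ {m n} → Permutation m n → Subset m → Subset n
image π e = tabulate λ y → lookup e (π ⟨$⟩ˡ y)

Isomorphic : ∀ {k m n} → Hypergraph k m → Hypergraph k n → Set
Isomorphic {_} {m} {n} Γ Δ =
  ∃[ π ] (∀ e → Edge Γ e ⇔ Edge Δ (image {m} {n} π e))

SelfComplementary : ∀ {k n} → Hypergraph k n → Set
SelfComplementary Γ = Isomorphic Γ (complement Γ)

subsets : ∀ n → List (Subset n)
subsets zero    = [] ∷ []
subsets (suc n) = map (outside ∷_) (subsets n) ++ map (inside ∷_) (subsets n)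

-- The next two lemmas show that filtering `subsets n` and taking the length
-- counts every subset with the given property exactly once.
∈-subsets : ∀ {n} (p : Subset n) → p ∈ subsets n
∈-subsets []          = here refl
∈-subsets (false ∷ p) = ∈-++⁺ˡ (∈-map⁺ (outside ∷_) (∈-subsets p))
∈-subsets (true  ∷ p) =
  ∈-++⁺ʳ (map (outside ∷_) (subsets _)) (∈-map⁺ (inside ∷_) (∈-subsets p))

subsets-unique : ∀ n → Unique (subsets n)
subsets-unique zero    = [] ∷ []
subsets-unique (suc n) =
  ++⁺ (map⁺ ∷-injectiveʳ (subsets-unique n))
      (map⁺ ∷-injectiveʳ (subsets-unique n))
      λ (o , i) → disjoint (∈-map⁻ (outside ∷_) o) (∈-map⁻ (inside ∷_) i)
  where
  disjoint : ∀ {v : Subset (suc n)} →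
             ∃[ p ] (p ∈ subsets n × v ≡ outside ∷ p) →
             ¬ (∃[ q ] (q ∈ subsets n × v ≡ inside ∷ q))
  disjoint (_ , _ , refl) (_ , _ , ())

degree : ∀ {k n} → Hypergraph k n → Subset n → ℕ
degree {n = n} Γ s =
  length (filter (λ e → edge? Γ e ×-dec (s ⊆? e)) (subsets n))

SubsetRegular : ∀ {k n} → ℕ → Hypergraph k n → Set
SubsetRegular {n = n} t Γ =
  ∃[ r ] (∀ (s : Subset n) → ∣ s ∣ ≡ t → degree Γ s ≡ r)

{-# OPTIONS --safe #-}
-- Give each point p of an edge candidate e the weight w_e(p) = ε(p) ∏_{q ∈ e} h(p,q)
-- with signs ε, h, and let a 3-set e be an edge when most of its weights are
-- positive.  If a fixed-point-free involution τ flips ε and preserves h, it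
-- negates all weights, hence maps edges to non-edges.  For signs a, b, c the
-- indicator of a positive majority is (2 + a + b + c − abc)/4.  Summed over all
-- r, with c the weight of r in {p,q,r}, the terms c − abc cancel along τ, so
-- the condition ∑_r h(p,r) = 2 h(p,p) forces every pair into n/2 − 1 edges.
-- For such an h, group the points into blocks {2i, 2i+1}, let alt be a
-- sign alternating over the blocks after the first, + on the first, and put
-- h(p,q) = alt(q), except h(p,q) = alt(p) when q is in the first block.
module Submission where

open import Defs
open import Algebra.Bundles using (AbelianGroup; CommutativeMonoid)
import Algebra.Properties.CommutativeMonoid.Sum as MonoidSum
import Algebra.Properties.Group as GroupProperties
import Algebra.Properties.Semiring.Sum as SemiringSum
open import Data.Bool.Base using (true; false; if_then_else_)
open import Data.Bool.Properties using (not-injective)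
open import Data.Fin.Base using (Fin; zero; suc)
open import Data.Fin.Permutation
  using (Permutation; permutation; _⟨$⟩ʳ_; inverseˡ)
open import Data.Fin.Subset using (Subset; inside; outside; _⊆_; ∁; ∣_∣)
open import Data.Fin.Subset.Properties
  using (_⊆?_; drop-∷-⊆; out⊆; in⊆in; p⊆q⇒∣p∣≤∣q∣)
open import Data.Integer.Base as ℤ using (ℤ; +_; 0ℤ; -_; _◃_)
import Data.Integer.Properties as ℤ
open import Data.Integer.Tactic.RingSolver using (solve-∀)
open import Data.List.Base using (List; []; _∷_; filter; length)
import Data.List.Base as List
open import Data.List.Properties using (filter-++; filter-≐; filter-none; length-++)
open import Data.List.Relation.Unary.All using (universal)
open import Data.Nat.Base using (ℕ; zero; suc; _+_; _*_; _/_; _≤_; _%_)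
open import Data.Nat.DivMod using (m≡m%n+[m/n]*n)
import Data.Nat.Properties as ℕ
open import Data.Product.Base using (∃-syntax; ∃₂; _×_; _,_; proj₁)
open import Data.Sign.Base as Sign using (Sign; opposite)
import Data.Sign.Properties as Sign
open import Data.Vec.Base using ([]; _∷_; _[_]≔_; lookup; here; tail)
open import Data.Vec.Properties using (lookup∘tabulate; lookup-map)
open import Function.Base using (_∘_; const)
open import Function.Bundles using (mk⇔)
open import Relation.Binary.PropositionalEquality
open import Relation.Nullary.Decidable
  using (Dec; yes; no; does; dec-true; dec-false; _×-dec_)
open import Relation.Nullary.Negation using (¬_; contradiction)
open import Relation.Unary using (Pred; Decidable)

-- Sums over subsets

module SubsetSum {c ℓ} (M : CommutativeMonoid c ℓ) where
  open CommutativeMonoid M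
    renaming (refl to ≈-refl; sym to ≈-sym; trans to ≈-trans; reflexive to ≈-reflexive)
  open MonoidSum M using (sum; sum-permute; sum-cong-≗)
  open import Algebra.Properties.CommutativeSemigroup commutativeSemigroup using (x∙yz≈y∙xz)

  -- A full sum over `Fin n` with the neutral element outside `s`, so that the invariance of `sum`
  -- under permutations carries over to images of subsets.
  sumOver : ∀ {n} → Subset n → (Fin n → Carrier) → Carrier
  sumOver s f = sum λ i → if lookup s i then f i else ε

  sumOver-cong : ∀ {n} (s : Subset n) {f g : Fin n → Carrier} →
                 (∀ i → lookup s i ≡ inside → f i ≈ g i) → sumOver s f ≈ sumOver s g
  sumOver-cong []          f≈g = ≈-refl
  sumOver-cong (true  ∷ s) f≈g = ∙-cong (f≈g zero refl) (sumOver-cong s (f≈g ∘ suc))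
  sumOver-cong (false ∷ s) f≈g = ∙-congˡ (sumOver-cong s (f≈g ∘ suc))

  sumOver-empty : ∀ {n} (s : Subset n) f → ∣ s ∣ ≡ 0 → sumOver s f ≈ ε
  sumOver-empty []          f _   = ≈-refl
  sumOver-empty (false ∷ s) f s≡0 = ≈-trans (identityˡ _) (sumOver-empty s (f ∘ suc) s≡0)

  sumOver-insert : ∀ {n} (s : Subset n) f p → lookup s p ≡ outside →
                   sumOver (s [ p ]≔ inside) f ≈ f p ∙ sumOver s f
  sumOver-insert (false ∷ s) f zero    _   = ∙-congˡ (≈-sym (identityˡ _))
  sumOver-insert (x ∷ s)     f (suc p) p∉s =
    ≈-trans (∙-congˡ (sumOver-insert s (f ∘ suc) p p∉s)) (x∙yz≈y∙xz _ _ _)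

  sumOver-∁ : ∀ {n} (s : Subset n) f → sum f ≈ sumOver s f ∙ sumOver (∁ s) f
  sumOver-∁ []          f = ≈-sym (identityˡ ε)
  sumOver-∁ (true  ∷ s) f = ≈-trans (∙-congˡ (sumOver-∁ s (f ∘ suc)))
    (≈-trans (≈-sym (assoc _ _ _)) (∙-congˡ (≈-sym (identityˡ _))))
  sumOver-∁ (false ∷ s) f = ≈-trans (∙-congˡ (sumOver-∁ s (f ∘ suc)))
    (≈-trans (x∙yz≈y∙xz _ _ _) (∙-congʳ (≈-sym (identityˡ _))))

  sumOver-image : ∀ {n} (π : Permutation n n) (s : Subset n) f →
                  sumOver (image π s) f ≈ sumOver s (f ∘ (π ⟨$⟩ʳ_))
  sumOver-image π s f = ≈-trans (sum-permute _ π) (≈-reflexive (sum-cong-≗ λ i →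
    cong (if_then f (π ⟨$⟩ʳ i) else ε)
      (trans (lookup∘tabulate _ (π ⟨$⟩ʳ i)) (cong (lookup s) (inverseˡ π)))))

open GroupProperties (AbelianGroup.group ℤ.+-0-abelianGroup) using () renaming (∙-cancelʳ to +-cancelʳ)
open SubsetSum ℕ.+-0-commutativeMonoid using () renaming (sumOver to ∑ℕ)
open SubsetSum ℤ.+-0-commutativeMonoid using () renaming (sumOver to ∑)
open SubsetSum Sign.*-commutativeMonoid using () renaming (sumOver to ∏)
module ∑ℕ = SubsetSum ℕ.+-0-commutativeMonoid
module ∑ = SubsetSum ℤ.+-0-commutativeMonoid
module ∏ = SubsetSum Sign.*-commutativeMonoid
open SemiringSum ℤ.+-*-semiring using (sum; sum-cong-≗; sum-permute; ∑-distrib-+; *-distribˡ-sum)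

∣∣≡∑ℕ1 : ∀ {n} (s : Subset n) → ∣ s ∣ ≡ ∑ℕ s (const 1)
∣∣≡∑ℕ1 []          = refl
∣∣≡∑ℕ1 (true  ∷ s) = cong suc (∣∣≡∑ℕ1 s)
∣∣≡∑ℕ1 (false ∷ s) = ∣∣≡∑ℕ1 s

∣image∣ : ∀ {n} (π : Permutation n n) (s : Subset n) → ∣ image π s ∣ ≡ ∣ s ∣
∣image∣ π s = trans (∣∣≡∑ℕ1 (image π s))
  (trans (∑ℕ.sumOver-image π s (const 1)) (sym (∣∣≡∑ℕ1 s)))

*-∑ℕ : ∀ {n} k (s : Subset n) f → + k ℤ.* + ∑ℕ s f ≡ ∑ s (λ i → + k ℤ.* + f i)
*-∑ℕ k []          f = ℤ.*-zeroʳ (+ k)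
*-∑ℕ k (true  ∷ s) f = trans (ℤ.*-distribˡ-+ (+ k) (+ f zero) (+ ∑ℕ s (f ∘ suc)))
  (cong (ℤ._+_ (+ k ℤ.* + f zero)) (*-∑ℕ k s (f ∘ suc)))
*-∑ℕ k (false ∷ s) f = trans (*-∑ℕ k s (f ∘ suc)) (sym (ℤ.+-identityˡ _))

sum-const : ∀ n k → sum {n} (const (+ k)) ≡ + (n * k)
sum-const zero    k = refl
sum-const (suc n) k = cong (ℤ._+_ (+ k)) (sum-const n k)

sum-zero : ∀ {n} (f : Fin n → ℤ) → (∀ i → f i ≡ 0ℤ) → sum f ≡ 0ℤ
sum-zero {n} f f≡0 = trans (sum-cong-≗ f≡0) (trans (sum-const n 0) (cong +_ (ℕ.*-zeroʳ n)))

i+i≡0⇒i≡0 : ∀ i → i ℤ.+ i ≡ 0ℤ → i ≡ 0ℤ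
i+i≡0⇒i≡0 (+ zero) _ = refl

-- Reindexing one copy along `π` and adding the other gives twice the sum, which vanishes termwise.
sum-odd : ∀ {n} (π : Permutation n n) (f : Fin n → ℤ) →
          (∀ i → f (π ⟨$⟩ʳ i) ℤ.+ f i ≡ 0ℤ) → sum f ≡ 0ℤ
sum-odd π f odd = i+i≡0⇒i≡0 (sum f) (begin
  sum f ℤ.+ sum f                    ≡⟨ cong (ℤ._+ sum f) (sum-permute f π) ⟩
  sum (f ∘ (π ⟨$⟩ʳ_)) ℤ.+ sum f      ≡⟨ ∑-distrib-+ (f ∘ (π ⟨$⟩ʳ_)) f ⟨
  sum (λ i → f (π ⟨$⟩ʳ i) ℤ.+ f i)   ≡⟨ sum-zero _ odd ⟩
  0ℤ                                 ∎)
  where open ≡-Reasoning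

-- Counting supersets

-- Repeated use turns a set of known size into explicit insertions into an empty set, where
-- `sumOver-insert` evaluates sums term by term.
extract : ∀ {n k} (s : Subset n) → ∣ s ∣ ≡ suc k →
          ∃₂ λ p t → lookup t p ≡ outside × ∣ t ∣ ≡ k × s ≡ t [ p ]≔ inside
extract (true  ∷ s) eq = zero , outside ∷ s , refl , ℕ.suc-injective eq , refl
extract (false ∷ s) eq with p , t , p∉t , ∣t∣ , s≡ ← extract s eq =
  suc p , outside ∷ t , p∉t , ∣t∣ , cong (outside ∷_) s≡

indicator : ∀ {p} {P : Set p} → Dec P → ℕ
indicator P? = if does P? then 1 else 0

count : ∀ {a p} {A : Set a} {P : Pred A p} → Decidable P → List A → ℕ
count P? xs = length (filter P? xs)

count-cong : ∀ {a p q} {A : Set a} {P : Pred A p} {Q : Pred A q}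
             (P? : Decidable P) (Q? : Decidable Q) →
             (∀ {x} → P x → Q x) → (∀ {x} → Q x → P x) →
             ∀ xs → count P? xs ≡ count Q? xs
count-cong P? Q? P⇒Q Q⇒P xs = cong length (filter-≐ P? Q? (P⇒Q , Q⇒P) xs)

count-none : ∀ {a p} {A : Set a} {P : Pred A p} (P? : Decidable P) →
             (∀ x → ¬ P x) → ∀ xs → count P? xs ≡ 0
count-none P? ¬P xs = cong length (filter-none P? (universal ¬P xs))

count-map : ∀ {a b p} {A : Set a} {B : Set b} {P : Pred B p} (P? : Decidable P) (f : A → B) →
            ∀ xs → count P? (List.map f xs) ≡ count (P? ∘ f) xs
count-map P? f []       = refl
count-map P? f (x ∷ xs) with does (P? (f x))
... | true  = cong suc (count-map P? f xs)
... | false = count-map P? f xs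

count-subsets : ∀ {n p} {P : Pred (Subset (suc n)) p} (P? : Decidable P) →
                count P? (subsets (suc n)) ≡
                count (P? ∘ (outside ∷_)) (subsets n) + count (P? ∘ (inside ∷_)) (subsets n)
count-subsets {n} P? = trans
  (cong length (filter-++ P? (List.map (outside ∷_) (subsets n)) _))
  (trans (length-++ (filter P? (List.map (outside ∷_) (subsets n))))
    (cong₂ _+_ (count-map P? _ (subsets n)) (count-map P? _ (subsets n))))

count-only : ∀ {n p} {P : Pred (Subset n) p} (P? : Decidable P) (s : Subset n) →
             (∀ {e} → P e → e ≡ s) → count P? (subsets n) ≡ indicator (P? s)
count-only P? [] _ with does (P? [])
... | true  = refl
... | false = refl
count-only {suc n} P? (true ∷ s) only = trans (count-subsets P?) (cong₂ _+_
  (count-none (P? ∘ (outside ∷_)) (λ _ Pe → contradiction (only Pe) λ ()) (subsets n))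
  (count-only (P? ∘ (inside ∷_)) s λ Pe → cong tail (only Pe)))
count-only {suc n} P? (false ∷ s) only = trans (count-subsets P?) (trans (cong₂ _+_
  (count-only (P? ∘ (outside ∷_)) s λ Pe → cong tail (only Pe))
  (count-none (P? ∘ (inside ∷_)) (λ _ Pe → contradiction (only Pe) λ ()) (subsets n)))
  (ℕ.+-identityʳ _))

⊆∧∣∣⇒≡ : ∀ {n} {s e : Subset n} → s ⊆ e → ∣ e ∣ ≡ ∣ s ∣ → e ≡ s
⊆∧∣∣⇒≡ {s = []}        {[]}        _   _  = refl
⊆∧∣∣⇒≡ {s = true ∷ _}  {true ∷ _}  s⊆e eq =
  cong (inside ∷_) (⊆∧∣∣⇒≡ (drop-∷-⊆ s⊆e) (ℕ.suc-injective eq))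
⊆∧∣∣⇒≡ {s = true ∷ _}  {false ∷ _} s⊆e eq = contradiction (s⊆e here) λ ()
⊆∧∣∣⇒≡ {s = false ∷ _} {true ∷ _}  s⊆e eq =
  contradiction (ℕ.≤-trans (ℕ.≤-reflexive eq) (p⊆q⇒∣p∣≤∣q∣ (drop-∷-⊆ s⊆e))) ℕ.1+n≰n
⊆∧∣∣⇒≡ {s = false ∷ _} {false ∷ _} s⊆e eq =
  cong (outside ∷_) (⊆∧∣∣⇒≡ (drop-∷-⊆ s⊆e) eq)

indicator-cong : ∀ {p q} {P : Set p} {Q : Set q} (P? : Dec P) (Q? : Dec Q) →
                 (P → Q) → (Q → P) → indicator P? ≡ indicator Q?
indicator-cong (yes p) Q? P⇒Q Q⇒P rewrite dec-true Q? (P⇒Q p) = refl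
indicator-cong (no ¬p) Q? P⇒Q Q⇒P rewrite dec-false Q? (¬p ∘ Q⇒P) = refl

-- The conjuncts are grouped as in `degree`, so that with `positive?` and `k = 3` the count of this
-- predicate is by definition a degree in the majority hypergraph.
superset? : ∀ {n p} {P : Pred (Subset n) p} → Decidable P → ∀ k s →
            Decidable λ e → (∣ e ∣ ≡ k × P e) × s ⊆ e
superset? P? k s e = (∣ e ∣ ℕ.≟ k ×-dec P? e) ×-dec (s ⊆? e)

-- A superset with one more element comes from a unique point `r` outside `s`. Induction on the
-- first point: if it is outside `s`, the only such superset containing it is the one with
-- `r = zero`; if it is in `s`, every superset contains it.
count-supersets : ∀ {n p} {P : Pred (Subset n) p} (P? : Decidable P) (s : Subset n) →
                  count (superset? P? (suc ∣ s ∣) s) (subsets n) ≡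
                  ∑ℕ (∁ s) (λ r → indicator (P? (s [ r ]≔ inside)))
count-supersets P? [] = refl
count-supersets {suc n} P? (false ∷ s) = trans (count-subsets Q?)
  -- `subsets` lists the sets without the first point first, whereas the sum starts with `r = zero`,
  -- the set that contains it.
  (trans (ℕ.+-comm (count (Q? ∘ (outside ∷_)) (subsets n)) _) (cong₂ _+_
    (trans
      (count-only (Q? ∘ (inside ∷_)) s λ ((eq , _) , s⊆e) →
        ⊆∧∣∣⇒≡ (drop-∷-⊆ s⊆e) (ℕ.suc-injective eq))
      (indicator-cong (Q? (inside ∷ s)) (P? (inside ∷ s))
        (λ ((_ , Pe) , _) → Pe) (λ Pe → (refl , Pe) , out⊆ λ x → x)))
    (trans
      (count-cong (Q? ∘ (outside ∷_)) (superset? (P? ∘ (outside ∷_)) (suc ∣ s ∣) s)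
        (λ (Pe , s⊆e) → Pe , drop-∷-⊆ s⊆e) (λ (Pe , s⊆e) → Pe , out⊆ s⊆e) (subsets n))
      (count-supersets (P? ∘ (outside ∷_)) s))))
  where Q? = superset? P? (suc ∣ s ∣) (outside ∷ s)
count-supersets {suc n} P? (true ∷ s) = trans (count-subsets Q?) (cong₂ _+_
  (count-none (Q? ∘ (outside ∷_)) (λ _ (_ , s⊆e) → contradiction (s⊆e here) λ ()) (subsets n))
  (trans
    (count-cong (Q? ∘ (inside ∷_)) (superset? (P? ∘ (inside ∷_)) (suc ∣ s ∣) s)
      (λ ((eq , Pe) , s⊆e) → (ℕ.suc-injective eq , Pe) , drop-∷-⊆ s⊆e)
      (λ ((eq , Pe) , s⊆e) → (cong suc eq , Pe) , in⊆in s⊆e) (subsets n))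
    (count-supersets (P? ∘ (inside ∷_)) s)))
  where Q? = superset? P? (2 + ∣ s ∣) (inside ∷ s)

-- Arithmetic of signs

⟦_⟧ : Sign → ℤ
⟦ a ⟧ = a ◃ 1

⟦⟧-* : ∀ a b → ⟦ a Sign.* b ⟧ ≡ ⟦ a ⟧ ℤ.* ⟦ b ⟧
⟦⟧-* Sign.+ Sign.+ = refl
⟦⟧-* Sign.+ Sign.- = refl
⟦⟧-* Sign.- Sign.+ = refl
⟦⟧-* Sign.- Sign.- = refl

⟦⟧-opposite : ∀ a → ⟦ opposite a ⟧ ≡ - ⟦ a ⟧
⟦⟧-opposite Sign.+ = refl
⟦⟧-opposite Sign.- = refl

opposite-* : ∀ a b → opposite a Sign.* b ≡ opposite (a Sign.* b)
opposite-* Sign.+ b = refl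
opposite-* Sign.- b = sym (Sign.opposite-involutive b)

-- Three odd numbers have an odd sum.
majority-nonzero : ∀ a b c → ⟦ a ⟧ ℤ.+ (⟦ b ⟧ ℤ.+ (⟦ c ⟧ ℤ.+ 0ℤ)) ≢ 0ℤ
majority-nonzero Sign.+ Sign.+ Sign.+ ()
majority-nonzero Sign.+ Sign.+ Sign.- ()
majority-nonzero Sign.+ Sign.- Sign.+ ()
majority-nonzero Sign.+ Sign.- Sign.- ()
majority-nonzero Sign.- Sign.+ Sign.+ ()
majority-nonzero Sign.- Sign.+ Sign.- ()
majority-nonzero Sign.- Sign.- Sign.+ ()
majority-nonzero Sign.- Sign.- Sign.- ()

-- The part of the majority expansion that is odd in `c`, kept apart because it cancels along the
-- involution.
twist : Sign → Sign → Sign → ℤ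
twist a b c = ⟦ c ⟧ ℤ.- ⟦ a Sign.* b Sign.* c ⟧

-- Four times the multilinear expansion of the indicator that at least two of three signs are
-- positive.
4majority : Sign → Sign → Sign → ℤ
4majority a b c = + 2 ℤ.+ ((⟦ a ⟧ ℤ.+ ⟦ b ⟧) ℤ.+ twist a b c)

-- `⟦ c ⟧` leads because `c` will be the weight of the newly inserted point, whose term
-- `sumOver-insert` puts first.
4majority-correct : ∀ a b c →
  + 4 ℤ.* + indicator (0ℤ ℤ.<? ⟦ c ⟧ ℤ.+ (⟦ a ⟧ ℤ.+ (⟦ b ⟧ ℤ.+ 0ℤ))) ≡ 4majority a b c
4majority-correct Sign.+ Sign.+ Sign.+ = refl
4majority-correct Sign.+ Sign.+ Sign.- = refl
4majority-correct Sign.+ Sign.- Sign.+ = refl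
4majority-correct Sign.+ Sign.- Sign.- = refl
4majority-correct Sign.- Sign.+ Sign.+ = refl
4majority-correct Sign.- Sign.+ Sign.- = refl
4majority-correct Sign.- Sign.- Sign.+ = refl
4majority-correct Sign.- Sign.- Sign.- = refl

-- The degenerate triple whose third point coincides with the first: since aba = b, the two
-- occurrences of `b` cancel.
4majority-aba : ∀ a b → 4majority a b a ≡ + 2 ℤ.+ (⟦ a ⟧ ℤ.+ ⟦ a ⟧)
4majority-aba Sign.+ Sign.+ = refl
4majority-aba Sign.+ Sign.- = refl
4majority-aba Sign.- Sign.+ = refl
4majority-aba Sign.- Sign.- = refl

4majority-abb : ∀ a b → 4majority a b b ≡ + 2 ℤ.+ (⟦ b ⟧ ℤ.+ ⟦ b ⟧)
4majority-abb Sign.+ Sign.+ = refl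
4majority-abb Sign.+ Sign.- = refl
4majority-abb Sign.- Sign.+ = refl
4majority-abb Sign.- Sign.- = refl

twist-odd : ∀ a b c → twist a b (opposite c) ℤ.+ twist a b c ≡ 0ℤ
twist-odd Sign.+ Sign.+ Sign.+ = refl
twist-odd Sign.+ Sign.+ Sign.- = refl
twist-odd Sign.+ Sign.- Sign.+ = refl
twist-odd Sign.+ Sign.- Sign.- = refl
twist-odd Sign.- Sign.+ Sign.+ = refl
twist-odd Sign.- Sign.+ Sign.- = refl
twist-odd Sign.- Sign.- Sign.+ = refl
twist-odd Sign.- Sign.- Sign.- = refl

∑-neg : ∀ {n} (s : Subset n) f → ∑ s (λ i → - f i) ≡ - ∑ s f
∑-neg []          f = refl
∑-neg (true  ∷ s) f = trans (cong (ℤ._+_ (- f zero)) (∑-neg s (f ∘ suc)))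
  (sym (ℤ.neg-distrib-+ (f zero) (∑ s (f ∘ suc))))
∑-neg (false ∷ s) f = trans (cong (ℤ._+_ 0ℤ) (∑-neg s (f ∘ suc)))
  (sym (ℤ.neg-distrib-+ 0ℤ (∑ s (f ∘ suc))))

-- The majority hypergraph of a system of weights

module Majority {n} (ε : Fin n → Sign) (h : Fin n → Fin n → Sign) where

  -- Defined for any set and any point, because the degree computation also uses weights of a pair
  -- at points outside it.
  weight : Subset n → Fin n → Sign
  weight e p = ε p Sign.* ∏ e (h p)

  total : Subset n → ℤ
  total e = ∑ e λ p → ⟦ weight e p ⟧

  positive? : Decidable λ e → 0ℤ ℤ.< total e
  positive? e = 0ℤ ℤ.<? total e

  hypergraph : Hypergraph 3 n
  hypergraph = record
    { Edge    = λ e → ∣ e ∣ ≡ 3 × 0ℤ ℤ.< total e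
    ; edge?   = λ e → (∣ e ∣ ℕ.≟ 3) ×-dec positive? e
    ; uniform = proj₁
    }

  weight-insert : ∀ s p r → lookup s r ≡ outside →
                  weight (s [ r ]≔ inside) p ≡ weight s p Sign.* h p r
  weight-insert s p r r∉s = begin
    ε p Sign.* ∏ (s [ r ]≔ inside) (h p)  ≡⟨ cong (ε p Sign.*_) (∏.sumOver-insert s (h p) r r∉s) ⟩
    ε p Sign.* (h p r Sign.* ∏ s (h p))   ≡⟨ cong (ε p Sign.*_) (Sign.*-comm (h p r) _) ⟩
    ε p Sign.* (∏ s (h p) Sign.* h p r)   ≡⟨ Sign.*-assoc (ε p) _ _ ⟨
    weight s p Sign.* h p r               ∎
    where open ≡-Reasoning

  -- Three insertions into an empty set display the total as a sum of three signs. With ties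
  -- excluded, a 3-set that is not an edge has negative total.
  total-nonzero : ∀ e → ∣ e ∣ ≡ 3 → total e ≢ 0ℤ
  total-nonzero e ∣e∣ total≡0
    with p , s , p∉s , ∣s∣ , refl ← extract e ∣e∣
    with q , t , q∉t , ∣t∣ , refl ← extract s ∣s∣
    with r , u , r∉u , ∣u∣ , refl ← extract t ∣t∣
    = majority-nonzero (w p) (w q) (w r) (trans (sym sum3) total≡0)
    where
    w = weight e
    sum3 : total e ≡ ⟦ w p ⟧ ℤ.+ (⟦ w q ⟧ ℤ.+ (⟦ w r ⟧ ℤ.+ 0ℤ))
    sum3 = trans (∑.sumOver-insert s _ p p∉s) (cong (ℤ._+_ ⟦ w p ⟧)
      (trans (∑.sumOver-insert t _ q q∉t) (cong (ℤ._+_ ⟦ w q ⟧)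
        (trans (∑.sumOver-insert u _ r r∉u) (cong (ℤ._+_ ⟦ w r ⟧)
          (∑.sumOver-empty u _ ∣u∣))))))

  -- Self-complementarity from a sign-reversing permutation

  module _ (π : Permutation n n)
           (ε-π : ∀ p → ε (π ⟨$⟩ʳ p) ≡ opposite (ε p))
           (h-πˡ : ∀ p q → h (π ⟨$⟩ʳ p) q ≡ h p q)
           (h-πʳ : ∀ p q → h p (π ⟨$⟩ʳ q) ≡ h p q)
    where

    weight-image : ∀ e p → weight (image π e) (π ⟨$⟩ʳ p) ≡ opposite (weight e p)
    weight-image e p = begin
      ε (π ⟨$⟩ʳ p) Sign.* ∏ (image π e) (h (π ⟨$⟩ʳ p))
        ≡⟨ cong₂ Sign._*_ (ε-π p) (trans (∏.sumOver-image π e _)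
             (∏.sumOver-cong e λ q _ → trans (h-πˡ p _) (h-πʳ p q))) ⟩
      opposite (ε p) Sign.* ∏ e (h p)
        ≡⟨ opposite-* (ε p) _ ⟩
      opposite (weight e p)
        ∎
      where open ≡-Reasoning

    total-image : ∀ e → total (image π e) ≡ - total e
    total-image e = begin
      ∑ (image π e) (λ p → ⟦ weight (image π e) p ⟧)
        ≡⟨ ∑.sumOver-image π e _ ⟩
      ∑ e (λ p → ⟦ weight (image π e) (π ⟨$⟩ʳ p) ⟧)
        ≡⟨ ∑.sumOver-cong e (λ p _ → trans (cong ⟦_⟧ (weight-image e p)) (⟦⟧-opposite _)) ⟩
      ∑ e (λ p → - ⟦ weight e p ⟧)
        ≡⟨ ∑-neg e _ ⟩
      - total e
        ∎
      where open ≡-Reasoning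

    selfComplementary : SelfComplementary hypergraph
    selfComplementary = π , λ e → mk⇔
      (λ (∣e∣ , 0<e) → trans (∣image∣ π e) ∣e∣ , λ (_ , 0<πe) →
        ℤ.<-asym 0<πe (subst (ℤ._< 0ℤ) (sym (total-image e)) (ℤ.neg-mono-< 0<e)))
      -- A negative total of `e` would make its image positive, hence an edge.
      (λ (∣πe∣ , ¬edge) → let ∣e∣ = trans (sym (∣image∣ π e)) ∣πe∣ in
        ∣e∣ , positive e ∣e∣ λ e<0 →
          ¬edge (∣πe∣ , subst (0ℤ ℤ.<_) (sym (total-image e)) (ℤ.neg-mono-< e<0)))
      where
      positive : ∀ e → ∣ e ∣ ≡ 3 → ¬ (total e ℤ.< 0ℤ) → 0ℤ ℤ.< total e
      positive e ∣e∣ e≮0 = ℤ.≤∧≢⇒< (ℤ.≮⇒≥ e≮0) (total-nonzero e ∣e∣ ∘ sym)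

    -- Degrees of pairs

    module _ (h-sum : ∀ p → sum (λ r → ⟦ h p r ⟧) ≡ ⟦ h p p ⟧ ℤ.+ ⟦ h p p ⟧) where

      sum-scaled : ∀ a p → sum (λ r → ⟦ a Sign.* h p r ⟧) ≡
                           ⟦ a Sign.* h p p ⟧ ℤ.+ ⟦ a Sign.* h p p ⟧
      sum-scaled a p = begin
        sum (λ r → ⟦ a Sign.* h p r ⟧)                 ≡⟨ sum-cong-≗ (λ r → ⟦⟧-* a (h p r)) ⟩
        sum (λ r → ⟦ a ⟧ ℤ.* ⟦ h p r ⟧)                ≡⟨ *-distribˡ-sum ⟦ a ⟧ (λ r → ⟦ h p r ⟧) ⟨
        ⟦ a ⟧ ℤ.* sum (λ r → ⟦ h p r ⟧)                ≡⟨ cong (ℤ._*_ ⟦ a ⟧) (h-sum p) ⟩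
        ⟦ a ⟧ ℤ.* (⟦ h p p ⟧ ℤ.+ ⟦ h p p ⟧)            ≡⟨ ℤ.*-distribˡ-+ ⟦ a ⟧ ⟦ h p p ⟧ ⟦ h p p ⟧ ⟩
        ⟦ a ⟧ ℤ.* ⟦ h p p ⟧ ℤ.+ ⟦ a ⟧ ℤ.* ⟦ h p p ⟧    ≡⟨ cong₂ ℤ._+_ (⟦⟧-* a (h p p)) (⟦⟧-* a (h p p)) ⟨
        ⟦ a Sign.* h p p ⟧ ℤ.+ ⟦ a Sign.* h p p ⟧      ∎
        where open ≡-Reasoning

      -- The sum of `g` over all points is evaluated twice. Split at `s`, it is four times the
      -- degree plus the two degenerate terms at `p` and `q`; summed as a whole, it is 2n plus the
      -- row sums of `h` scaled by weights. By `h-sum` these row sums match the sign terms of the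
      -- degenerate part, leaving the constant 4.
      degree-equation : ∀ s → ∣ s ∣ ≡ 2 → + 4 ℤ.* + degree hypergraph s ℤ.+ + 4 ≡ + (n * 2)
      degree-equation s ∣s∣
        with p , t , p∉t , ∣t∣ , s≡ ← extract s ∣s∣
        with q , u , q∉u , ∣u∣ , t≡ ← extract t ∣t∣
        = cancel 4deg (⟦ a p ⟧ ℤ.+ ⟦ a p ⟧) (⟦ b q ⟧ ℤ.+ ⟦ b q ⟧) (begin
          (+ 2 ℤ.+ (⟦ a p ⟧ ℤ.+ ⟦ a p ⟧)) ℤ.+ ((+ 2 ℤ.+ (⟦ b q ⟧ ℤ.+ ⟦ b q ⟧)) ℤ.+ 0ℤ) ℤ.+ 4deg
            ≡⟨ cong₂ ℤ._+_ sum-s sum-∁s ⟨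
          ∑ s g ℤ.+ ∑ (∁ s) g
            ≡⟨ ∑.sumOver-∁ s g ⟨
          sum g
            ≡⟨ sum-all ⟩
          + (n * 2) ℤ.+ ((⟦ a p ⟧ ℤ.+ ⟦ a p ⟧) ℤ.+ (⟦ b q ⟧ ℤ.+ ⟦ b q ⟧) ℤ.+ 0ℤ)
            ∎)
        where
        open ≡-Reasoning

        -- For `r` outside `s` these are the weights of `p`, `q` and `r` in the triple. The same
        -- formulas at `r` in `s` give `c p = a p` and `c q = b q`.
        a b c : Fin n → Sign
        a r = weight s p Sign.* h p r
        b r = weight s q Sign.* h q r
        c r = weight s r Sign.* h r r

        d g : Fin n → ℤ
        d r = twist (a r) (b r) (c r)
        g r = 4majority (a r) (b r) (c r)

        4deg : ℤ
        4deg = + 4 ℤ.* + degree hypergraph s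

        ∑-s : ∀ f → ∑ s f ≡ f p ℤ.+ (f q ℤ.+ 0ℤ)
        ∑-s f = trans (cong (λ s → ∑ s f) s≡)
          (trans (∑.sumOver-insert t f p p∉t) (cong (ℤ._+_ (f p))
            (trans (cong (λ t → ∑ t f) t≡)
              (trans (∑.sumOver-insert u f q q∉u) (cong (ℤ._+_ (f q))
                (∑.sumOver-empty u f ∣u∣))))))

        sum-s : ∑ s g ≡ (+ 2 ℤ.+ (⟦ a p ⟧ ℤ.+ ⟦ a p ⟧)) ℤ.+ ((+ 2 ℤ.+ (⟦ b q ⟧ ℤ.+ ⟦ b q ⟧)) ℤ.+ 0ℤ)
        sum-s = trans (∑-s g) (cong₂ (λ x y → x ℤ.+ (y ℤ.+ 0ℤ))
          (4majority-aba (a p) (b p)) (4majority-abb (a q) (b q)))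

        c-odd : ∀ r → c (π ⟨$⟩ʳ r) ≡ opposite (c r)
        c-odd r = begin
          (ε (π ⟨$⟩ʳ r) Sign.* ∏ s (h (π ⟨$⟩ʳ r))) Sign.* h (π ⟨$⟩ʳ r) (π ⟨$⟩ʳ r)
            ≡⟨ cong₂ Sign._*_ (cong₂ Sign._*_ (ε-π r) (∏.sumOver-cong s λ x _ → h-πˡ r x))
                 (trans (h-πˡ r _) (h-πʳ r r)) ⟩
          (opposite (ε r) Sign.* ∏ s (h r)) Sign.* h r r
            ≡⟨ cong (Sign._* h r r) (opposite-* (ε r) _) ⟩
          opposite (weight s r) Sign.* h r r
            ≡⟨ opposite-* (weight s r) _ ⟩
          opposite (c r)
            ∎

        -- `r` enters `a` and `b` only through the second argument of `h`, where `π` has no effect;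
        -- only `c` changes sign.
        twist≡ : ∀ r → d (π ⟨$⟩ʳ r) ≡ twist (a r) (b r) (opposite (c r))
        twist≡ r = trans
          (cong₂ (λ x y → twist x y (c (π ⟨$⟩ʳ r)))
            (cong (weight s p Sign.*_) (h-πʳ p r)) (cong (weight s q Sign.*_) (h-πʳ q r)))
          (cong (twist (a r) (b r)) (c-odd r))

        sum-all : sum g ≡ + (n * 2) ℤ.+
                  ((⟦ a p ⟧ ℤ.+ ⟦ a p ⟧) ℤ.+ (⟦ b q ⟧ ℤ.+ ⟦ b q ⟧) ℤ.+ 0ℤ)
        sum-all = trans (∑-distrib-+ (const (+ 2)) λ r → (⟦ a r ⟧ ℤ.+ ⟦ b r ⟧) ℤ.+ d r)
          (cong₂ ℤ._+_ (sum-const n 2)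
          (trans (∑-distrib-+ (λ r → ⟦ a r ⟧ ℤ.+ ⟦ b r ⟧) d) (cong₂ ℤ._+_
            (trans (∑-distrib-+ (⟦_⟧ ∘ a) (⟦_⟧ ∘ b))
              (cong₂ ℤ._+_ (sum-scaled (weight s p) p) (sum-scaled (weight s q) q)))
            (sum-odd π d λ r → trans
              (cong (ℤ._+ d r) (twist≡ r)) (twist-odd (a r) (b r) (c r))))))

        total-insert : ∀ r → lookup s r ≡ outside →
          total (s [ r ]≔ inside) ≡ ⟦ c r ⟧ ℤ.+ (⟦ a r ⟧ ℤ.+ (⟦ b r ⟧ ℤ.+ 0ℤ))
        total-insert r r∉s = trans
          (∑.sumOver-insert s _ r r∉s)
          (trans (cong (ℤ._+_ ⟦ weight (s [ r ]≔ inside) r ⟧) (∑-s _))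
            (cong₂ ℤ._+_ (insert r) (cong₂ ℤ._+_ (insert p) (cong (ℤ._+ 0ℤ) (insert q)))))
          where
          insert : ∀ x → ⟦ weight (s [ r ]≔ inside) x ⟧ ≡ ⟦ weight s x Sign.* h x r ⟧
          insert x = cong ⟦_⟧ (weight-insert s x r r∉s)

        sum-∁s : ∑ (∁ s) g ≡ 4deg
        sum-∁s = sym (begin
          + 4 ℤ.* + degree hypergraph s
            ≡⟨ cong (λ d → + 4 ℤ.* + d) (trans
                 -- The sizes `3` and `suc ∣ s ∣` agree only propositionally, through `∣s∣`.
                 (count-cong (superset? positive? 3 s) (superset? positive? (suc ∣ s ∣) s)
                   (λ ((∣e∣ , 0<e) , s⊆e) → (trans ∣e∣ (cong suc (sym ∣s∣)) , 0<e) , s⊆e)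
                   (λ ((∣e∣ , 0<e) , s⊆e) → (trans ∣e∣ (cong suc ∣s∣) , 0<e) , s⊆e) (subsets n))
                 (count-supersets positive? s)) ⟩
          + 4 ℤ.* + ∑ℕ (∁ s) (λ r → indicator (positive? (s [ r ]≔ inside)))
            ≡⟨ *-∑ℕ 4 (∁ s) _ ⟩
          ∑ (∁ s) (λ r → + 4 ℤ.* + indicator (positive? (s [ r ]≔ inside)))
            ≡⟨ ∑.sumOver-cong (∁ s) (λ r r∈∁s → trans
                 (cong (λ z → + 4 ℤ.* + indicator (0ℤ ℤ.<? z))
                   (total-insert r (not-injective (trans (sym (lookup-map r _ s)) r∈∁s))))
                 (4majority-correct (a r) (b r) (c r))) ⟩
          ∑ (∁ s) g
            ∎)

        cancel : ∀ d x y {N} →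
                 (+ 2 ℤ.+ x) ℤ.+ ((+ 2 ℤ.+ y) ℤ.+ 0ℤ) ℤ.+ d ≡ N ℤ.+ (x ℤ.+ y ℤ.+ 0ℤ) →
                 d ℤ.+ + 4 ≡ N
        cancel d x y {N} eq = +-cancelʳ (x ℤ.+ y ℤ.+ 0ℤ) _ _ (trans (rearrange d x y) eq)
          where
          rearrange : ∀ d x y → (d ℤ.+ + 4) ℤ.+ (x ℤ.+ y ℤ.+ 0ℤ) ≡
                      (+ 2 ℤ.+ x) ℤ.+ ((+ 2 ℤ.+ y) ℤ.+ 0ℤ) ℤ.+ d
          rearrange = solve-∀

-- The weights on 2 + 4 m points

-- The size is written `k * 2` so that `suc k * 2` reduces to two successors and a whole block can
-- be matched at once.
twin : ∀ k → Fin (k * 2) → Fin (k * 2)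
twin (suc k) zero          = suc zero
twin (suc k) (suc zero)    = zero
twin (suc k) (suc (suc i)) = suc (suc (twin k i))

twin-involutive : ∀ k i → twin k (twin k i) ≡ i
twin-involutive (suc k) zero          = refl
twin-involutive (suc k) (suc zero)    = refl
twin-involutive (suc k) (suc (suc i)) = cong (λ j → suc (suc j)) (twin-involutive k i)

swap : ∀ k → Permutation (k * 2) (k * 2)
swap k = permutation (twin k) (twin k) (twin-involutive k) (twin-involutive k)

-- Serves twice: on points as the sign `ε`, and on blocks after the first as the alternating sign.
parity : ∀ {k} → Fin k → Sign
parity zero    = Sign.+
parity (suc i) = opposite (parity i)

parity-twin : ∀ k i → parity (twin k i) ≡ opposite (parity i)
parity-twin (suc k) zero          = refl
parity-twin (suc k) (suc zero)    = refl
parity-twin (suc k) (suc (suc i)) =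
  cong (λ a → opposite (opposite a)) (parity-twin k i)

block : ∀ k → Fin (k * 2) → Fin k
block (suc k) zero          = zero
block (suc k) (suc zero)    = zero
block (suc k) (suc (suc i)) = suc (block k i)

block-twin : ∀ k i → block k (twin k i) ≡ block k i
block-twin (suc k) zero          = refl
block-twin (suc k) (suc zero)    = refl
block-twin (suc k) (suc (suc i)) = cong suc (block-twin k i)

sum-block : ∀ k (f : Fin k → ℤ) → sum (f ∘ block k) ≡ sum f ℤ.+ sum f
sum-block zero    f = refl
sum-block (suc k) f = trans
  (cong (λ z → f zero ℤ.+ (f zero ℤ.+ z)) (sum-block k (f ∘ suc)))
  (rearrange (f zero) (sum (f ∘ suc)))
  where
  rearrange : ∀ x y → x ℤ.+ (x ℤ.+ (y ℤ.+ y)) ≡ (x ℤ.+ y) ℤ.+ (x ℤ.+ y)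
  rearrange = solve-∀

-- `twin` pairs positions of opposite sign.
sum-parity : ∀ k → sum {k * 2} (⟦_⟧ ∘ parity) ≡ 0ℤ
sum-parity k = sum-odd (swap k) (⟦_⟧ ∘ parity) λ i → trans
  (cong (λ a → ⟦ a ⟧ ℤ.+ ⟦ parity i ⟧) (parity-twin k i)) (opposite-cancels (parity i))
  where
  opposite-cancels : ∀ a → ⟦ opposite a ⟧ ℤ.+ ⟦ a ⟧ ≡ 0ℤ
  opposite-cancels Sign.+ = refl
  opposite-cancels Sign.- = refl

alt : ∀ {k} → Fin (suc k) → Sign
alt zero    = Sign.+
alt (suc i) = parity i

-- A sign matrix on blocks. Its rows agree outside the first column, and there the alternating signs
-- cancel when `k` is even; the first column repeats the diagonal, so each row then sums to its
-- diagonal entry.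
link : ∀ {k} → Fin (suc k) → Fin (suc k) → Sign
link i zero    = alt i
link i (suc j) = parity j

link-diagonal : ∀ {k} (i : Fin (suc k)) → link i i ≡ alt i
link-diagonal zero    = refl
link-diagonal (suc i) = refl

sum-link : ∀ k (i : Fin (suc (k * 2))) → sum (⟦_⟧ ∘ link i) ≡ ⟦ link i i ⟧
sum-link k i = trans (cong (ℤ._+_ ⟦ alt i ⟧) (sum-parity k))
  (trans (ℤ.+-identityʳ _) (cong ⟦_⟧ (sym (link-diagonal i))))

theorem1 : ∀ (n : ℕ) → 6 ≤ n → n % 4 ≡ 2 →
    ∃[ Γ ] (SubsetRegular {3} {n} 2 Γ × SelfComplementary Γ)
theorem1 n _ n%4≡2 = subst (λ n → ∃[ Γ ] (SubsetRegular {3} {n} 2 Γ × SelfComplementary Γ))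
  -- The degree `m * 2` is n/2 - 1 for n = 4m + 2.
  (sym n≡) (hypergraph , (m * 2 , regular) , selfComplementary τ (parity-twin blocks) h-twinˡ h-twinʳ)
  where
  m blocks : ℕ
  m = n / 4
  -- An odd number of blocks, which leaves an even number after the first, as `sum-link` requires;
  -- here the residue of n modulo 4 enters.
  blocks = suc (m * 2)

  n≡ : n ≡ blocks * 2
  n≡ = trans (m≡m%n+[m/n]*n n 4)
    (cong₂ _+_ n%4≡2 (sym (ℕ.*-assoc m 2 2)))

  τ : Permutation (blocks * 2) (blocks * 2)
  τ = swap blocks

  h : Fin (blocks * 2) → Fin (blocks * 2) → Sign
  h p q = link (block blocks p) (block blocks q)

  open Majority {blocks * 2} parity h

  h-twinˡ : ∀ p q → h (twin blocks p) q ≡ h p q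
  h-twinˡ p q = cong (λ i → link i (block blocks q)) (block-twin blocks p)

  h-twinʳ : ∀ p q → h p (twin blocks q) ≡ h p q
  h-twinʳ p q = cong (link (block blocks p)) (block-twin blocks q)

  h-sum : ∀ p → sum (λ r → ⟦ h p r ⟧) ≡ ⟦ h p p ⟧ ℤ.+ ⟦ h p p ⟧
  -- Each block has two points, so the row sum over blocks is doubled; this is the factor 2 in the
  -- condition on `h`.
  h-sum p = trans (sum-block blocks (⟦_⟧ ∘ link (block blocks p)))
    (cong₂ ℤ._+_ (sum-link m (block blocks p)) (sum-link m (block blocks p)))

  regular : ∀ s → ∣ s ∣ ≡ 2 → degree hypergraph s ≡ m * 2
  regular s ∣s∣ = ℕ.*-cancelˡ-≡ _ _ 4 (ℕ.+-cancelʳ-≡ 4 _ _ (ℤ.+-injective (begin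
    + (4 * d + 4)              ≡⟨ cong (ℤ._+ + 4) (ℤ.pos-* 4 d) ⟩
    + 4 ℤ.* + d ℤ.+ + 4        ≡⟨ degree-equation τ (parity-twin blocks) h-twinˡ h-twinʳ h-sum s ∣s∣ ⟩
    + (blocks * 2 * 2)         ≡⟨ cong +_ (rearrange (m * 2)) ⟩
    + (4 * (m * 2) + 4)        ∎)))
    where
    open ≡-Reasoning
    d = degree hypergraph s
    rearrange : ∀ x → suc x * 2 * 2 ≡ 4 * x + 4
    rearrange x = trans (ℕ.*-assoc (suc x) 2 2)
      (trans (ℕ.*-comm (suc x) 4) (trans (ℕ.*-suc 4 x) (ℕ.+-comm 4 (4 * x))))
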